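{- Let $G$ be a finite, simple, undirected graph with $n \ge 2$ vertices, not necessarily connected, and let $\Delta(G)$ denote its maximum degree. Then $b(G) = 2$ if and only if $\Delta(G) \geq n-2$.
   Context: Graph burning: initially all vertices of a finite simple undirected graph $G$ are unburned. The process runs in rounds $t = 1, 2, 3, \dots$. In round $t$, a vertex $x_t$ that is not burned at the end of round $t-1$ is chosen as a new source of fire and becomes burned; simultaneously, every vertex adjacent to a vertex that was burned at the end of round $t-1$ becomes burned. Burned vertices remain burned. The process ends at the first round after which all vertices of $G$ are burned. The sequence $(x_1, x_2, \dots, x_k)$ of chosen sources is called a burning sequence. The burning number $b(G)$ is the minimum, over all choices of sources, of the number of rounds needed to burn all vertices of $G$ (the minimum length of a burning sequence). -}

module Defs where

open import Data.Fin using (Fin)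
open import Data.Fin.Properties using (any?; all?; ¬∀⟶∃¬)
open import Data.Fin.Subset using (Subset; _∈_; _∉_; _∪_; _⊃_; ⁅_⁆; ⊥; ∣_∣)
open import Data.Fin.Subset.Induction using (⊃-wellFounded)
open import Data.Fin.Subset.Properties using (_∈?_; p⊆p∪q; q⊆p∪q; x∈⁅x⁆)
open import Data.List using (map; allFin)
open import Data.List.Extrema.Nat using (max)
open import Data.Nat using (ℕ; zero; suc; _≤_; z≤n; s≤s)
open import Data.Product using (∃; ∃-syntax; _×_; _,_; proj₁; proj₂)
open import Data.Vec using (Vec; []; _∷_; tabulate)
open import Function using (_∘_)
open import Induction.WellFounded using (Acc; acc)
open import Level using (0ℓ)
open import Relation.Binary.Core using (Rel)
open import Relation.Binary.Definitions as B using (Symmetric; Irreflexive)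
open import Relation.Binary.PropositionalEquality using (_≡_)
open import Relation.Nullary using (yes; no; does; contradiction)
open import Relation.Nullary.Decidable using (¬?; _×-dec_; map′)
open import Relation.Unary as U using (Pred)

record SimpleGraph (n : ℕ) : Set₁ where
  field
    Adj    : Rel (Fin n) 0ℓ
    adj?   : B.Decidable Adj
    sym    : Symmetric Adj
    irrefl : Irreflexive _≡_ Adj

Least : Pred ℕ 0ℓ → Pred ℕ 0ℓ
Least P k = P k × (∀ {j} → P j → k ≤ j)

least : ∀ {P : Pred ℕ 0ℓ} → U.Decidable P → ∀ m → P m → ∃ (Least P)
least P? zero p = zero , p , λ _ → z≤n
least {P} P? (suc m) p with P? zero
... | yes p₀ = zero , p₀ , λ _ → z≤n
... | no ¬p₀ with least (P? ∘ suc) m p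
...   | k , pk , k-min = suc k , pk , k+1-min _
  where
  k+1-min : ∀ j → P j → suc k ≤ j
  k+1-min zero    p₀ = contradiction p₀ ¬p₀
  k+1-min (suc j) pj = s≤s (k-min pj)

module _ {n : ℕ} (G : SimpleGraph n) where
  open SimpleGraph G

  neighbours : Fin n → Subset n
  neighbours u = tabulate λ v → does (adj? u v)

  degree : Fin n → ℕ
  degree u = ∣ neighbours u ∣

  -- The default value 0 only matters when there are no vertices.
  maxDegree : ℕ
  maxDegree = max 0 (map degree (allFin n))

  spread : Subset n → Subset n
  spread B = tabulate λ v → does (any? λ u → (u ∈? B) ×-dec adj? u v)

  -- The burned set after a round that starts with B burned and has new source x.
  burnRound : Subset n → Fin n → Subset n
  burnRound B x = (B ∪ spread B) ∪ ⁅ x ⁆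

  -- BurnsFrom B xs: starting with B burned, the successive sources xs are legal
  -- and the process ends exactly when they are used up. Since every source is
  -- unburned when chosen, no earlier round can have burned all vertices.
  data BurnsFrom (B : Subset n) : ∀ {k} → Vec (Fin n) k → Set where
    done  : (∀ v → v ∈ B) → BurnsFrom B []
    round : ∀ {k x} {xs : Vec (Fin n) k} →
            x ∉ B → BurnsFrom (burnRound B x) xs → BurnsFrom B (x ∷ xs)

  BurningSequence : ∀ {k} → Vec (Fin n) k → Set
  BurningSequence = BurnsFrom ⊥

  BurnableFrom : Subset n → Pred ℕ 0ℓ
  BurnableFrom B k = ∃[ xs ] BurnsFrom B {k} xs

  burnableFrom? : ∀ B → U.Decidable (BurnableFrom B)
  burnableFrom? B zero = map′ (λ full → [] , done full)
                              (λ { ([] , done full) → full })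
                              (all? (_∈? B))
  burnableFrom? B (suc k) =
    map′ (λ { (x , x∉B , xs , b) → x ∷ xs , round x∉B b })
         (λ { (x ∷ xs , round x∉B b) → x , x∉B , xs , b })
         (any? λ x → ¬? (x ∈? B) ×-dec burnableFrom? (burnRound B x) k)

  burnableFrom : ∀ B → ∃ (BurnableFrom B)
  burnableFrom B = go B (⊃-wellFounded B)
    where
    go : ∀ B → Acc _⊃_ B → ∃ (BurnableFrom B)
    go B (acc rec) with all? (_∈? B)
    ... | yes full = zero , [] , done full
    ... | no ¬full with ¬∀⟶∃¬ n (_∈ B) (_∈? B) ¬full
    ...   | x , x∉B with go (burnRound B x) (rec (B⊆ , x , x∈ , x∉B))
      where
      B⊆ : ∀ {v} → v ∈ B → v ∈ burnRound B x
      B⊆ = p⊆p∪q ⁅ x ⁆ ∘ p⊆p∪q (spread B)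
      x∈ : x ∈ burnRound B x
      x∈ = q⊆p∪q (B ∪ spread B) ⁅ x ⁆ (x∈⁅x⁆ x)
    ...     | k , xs , b = suc k , x ∷ xs , round x∉B b

  shortestBurning : ∃ (Least (λ k → ∃[ xs ] BurningSequence {k} xs))
  shortestBurning = least (burnableFrom? ⊥) (proj₁ (burnableFrom ⊥)) (proj₂ (burnableFrom ⊥))

  burningNumber : ℕ
  burningNumber = proj₁ shortestBurning

{-# OPTIONS --safe #-}

-- When the first source u and then x are lit, the burned set after two rounds is
-- N(u) ∪ {u} ∪ {x}, so two rounds suffice exactly when some closed neighbourhood
-- misses at most one vertex. One round burns a single vertex, which is too few.
module Submission where

open import Defs
open import Data.Bool using (true; false)
open import Data.Fin using (Fin; zero; suc; punchIn)
open import Data.Fin.Properties using (any?; punchInᵢ≢i)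
open import Data.Fin.Subset using (Subset; _∈_; _∉_; _∪_; ⁅_⁆; ⊥; ⊤; ∣_∣)
open import Data.Fin.Subset.Properties
  using ( _∈?_; ∉⊥; x∈⁅x⁆; x∈⁅y⁆⇒x≡y; ∣⁅x⁆∣≡1; ∣⊤∣≡n; ∣p∣≤n; p⊆q⇒∣p∣≤∣q∣; p⊂q⇒∣p∣<∣q∣
        ; p⊆p∪q; q⊆p∪q; ∪-comm; ∪-identityˡ)
open import Data.List using (map; allFin)
open import Data.List.Extrema.Nat using (argmax-sel; xs≤max)
open import Data.List.Membership.Propositional.Properties using (∈-map⁺; ∈-map⁻; ∈-allFin)
open import Data.List.Relation.Unary.All as All using ()
open import Data.Nat using (ℕ; zero; suc; _+_; _≤_; _<_; _≥_; _∸_; z≤n; s≤s)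
open import Data.Nat.Properties
  using ( ≤-reflexive; ≤-trans; ≤-antisym; <⇒≱; m≤n⇒m≤1+n; +-comm; +-suc
        ; m≤n+o⇒m∸n≤o; module ≤-Reasoning)
open import Data.Product using (∃-syntax; _×_; _,_; proj₁; proj₂)
open import Data.Sum using (inj₁; inj₂)
open import Data.Vec using ([]; _∷_; lookup)
open import Data.Vec.Properties
  using ([]=⇒lookup; lookup∘tabulate; lookup-replicate; tabulate-cong; tabulate∘lookup)
open import Function using (_∘_; id)
open import Function.Bundles using (_⇔_; mk⇔)
open import Relation.Binary.PropositionalEquality
  using (_≡_; _≢_; refl; sym; trans; cong; subst; module ≡-Reasoning)
open import Relation.Nullary using (yes; no; contradiction)
open import Relation.Nullary.Decidable using (¬?; _×-dec_; dec-false; does-⇔; decidable-stable)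

∣p∪q∣≤∣p∣+∣q∣ : ∀ {n} (p q : Subset n) → ∣ p ∪ q ∣ ≤ ∣ p ∣ + ∣ q ∣
∣p∪q∣≤∣p∣+∣q∣ []          []          = z≤n
∣p∪q∣≤∣p∣+∣q∣ (true  ∷ p) (true  ∷ q) =
  -- A shared element counts once on the left and twice on the right, hence the slack of one.
  s≤s (≤-trans (m≤n⇒m≤1+n (∣p∪q∣≤∣p∣+∣q∣ p q)) (≤-reflexive (sym (+-suc ∣ p ∣ ∣ q ∣))))
∣p∪q∣≤∣p∣+∣q∣ (true  ∷ p) (false ∷ q) = s≤s (∣p∪q∣≤∣p∣+∣q∣ p q)
∣p∪q∣≤∣p∣+∣q∣ (false ∷ p) (true  ∷ q) =
  ≤-trans (s≤s (∣p∪q∣≤∣p∣+∣q∣ p q)) (≤-reflexive (sym (+-suc ∣ p ∣ ∣ q ∣)))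
∣p∪q∣≤∣p∣+∣q∣ (false ∷ p) (false ∷ q) = ∣p∪q∣≤∣p∣+∣q∣ p q

∣p∪⁅x⁆∣≤1+∣p∣ : ∀ {n} (p : Subset n) x → ∣ p ∪ ⁅ x ⁆ ∣ ≤ suc ∣ p ∣
∣p∪⁅x⁆∣≤1+∣p∣ p x = begin
  ∣ p ∪ ⁅ x ⁆ ∣      ≤⟨ ∣p∪q∣≤∣p∣+∣q∣ p ⁅ x ⁆ ⟩
  ∣ p ∣ + ∣ ⁅ x ⁆ ∣  ≡⟨ cong (∣ p ∣ +_) (∣⁅x⁆∣≡1 x) ⟩
  ∣ p ∣ + 1          ≡⟨ +-comm ∣ p ∣ 1 ⟩
  suc ∣ p ∣          ∎
  where open ≤-Reasoning

x∉p⇒∣p∣<∣p∪⁅x⁆∣ : ∀ {n} {p : Subset n} {x} → x ∉ p → ∣ p ∣ < ∣ p ∪ ⁅ x ⁆ ∣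
x∉p⇒∣p∣<∣p∪⁅x⁆∣ {p = p} {x} x∉p =
  p⊂q⇒∣p∣<∣q∣ (p⊆p∪q ⁅ x ⁆ , x , q⊆p∪q p ⁅ x ⁆ (x∈⁅x⁆ x) , x∉p)

full⇒n≤∣p∣ : ∀ {n} {p : Subset n} → (∀ v → v ∈ p) → n ≤ ∣ p ∣
full⇒n≤∣p∣ {n} {p} full = subst (_≤ ∣ p ∣) (∣⊤∣≡n n) (p⊆q⇒∣p∣≤∣q∣ {p = ⊤} (λ {v} _ → full v))

-- If some `v` were missing, `p ∪ ⁅ v ⁆` would have more than `n` elements.
n≤∣p∣⇒full : ∀ {n} {p : Subset n} → n ≤ ∣ p ∣ → ∀ v → v ∈ p
n≤∣p∣⇒full {p = p} n≤∣p∣ v = decidable-stable (v ∈? p) λ v∉p →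
  <⇒≱ (x∉p⇒∣p∣<∣p∪⁅x⁆∣ v∉p) (≤-trans (∣p∣≤n (p ∪ ⁅ v ⁆)) n≤∣p∣)

-- Supplies the second source: `p` will be the closed neighbourhood of the first source `u`, and
-- `x ≢ u` keeps `x` unburned when it is chosen.
completingVertex : ∀ {m} {p : Subset (suc (suc m))} {u} → u ∈ p → suc m ≤ ∣ p ∣ →
                   ∃[ x ] x ≢ u × (∀ v → v ∈ p ∪ ⁅ x ⁆)
completingVertex {p = p} {u} u∈p m<∣p∣ with any? (¬? ∘ (_∈? p))
... | yes (x , x∉p) =
  x , (λ { refl → x∉p u∈p }) , n≤∣p∣⇒full (≤-trans (s≤s m<∣p∣) (x∉p⇒∣p∣<∣p∪⁅x⁆∣ x∉p))
... | no p-full =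
  -- Nothing is left to cover, but a second source is still due; with at least two vertices there is
  -- one other than `u`.
  punchIn u zero , punchInᵢ≢i u zero ,
  λ v → p⊆p∪q _ (decidable-stable (v ∈? p) λ v∉p → p-full (v , v∉p))

module _ {n : ℕ} (G : SimpleGraph n) where
  open SimpleGraph G using (Adj; adj?; irrefl)

  u∉neighbours : ∀ u → u ∉ neighbours G u
  u∉neighbours u u∈N with () ← trans (sym ([]=⇒lookup u∈N))
    (trans (lookup∘tabulate _ u) (dec-false (adj? u u) (irrefl refl)))

  spread-⊥ : spread G ⊥ ≡ ⊥
  spread-⊥ = trans (tabulate-cong unreached) (tabulate∘lookup ⊥)
    where
    unreached : ∀ v → _ ≡ lookup ⊥ v
    unreached v = trans
      (dec-false (any? λ u → (u ∈? ⊥) ×-dec adj? u v) λ { (_ , u∈⊥ , _) → ∉⊥ u∈⊥ })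
      (sym (lookup-replicate v false))

  spread-⁅_⁆ : ∀ u → spread G ⁅ u ⁆ ≡ neighbours G u
  spread-⁅ u ⁆ = tabulate-cong λ v → does-⇔
    (mk⇔ (λ { (w , w∈⁅u⁆ , w~v) → subst (λ z → Adj z v) (x∈⁅y⁆⇒x≡y u w∈⁅u⁆) w~v })
         (λ u~v → u , x∈⁅x⁆ u , u~v))
    (any? λ w → (w ∈? ⁅ u ⁆) ×-dec adj? w v) (adj? u v)

  burnRound-⊥ : ∀ u → burnRound G ⊥ u ≡ ⁅ u ⁆
  burnRound-⊥ u = begin
    (⊥ ∪ spread G ⊥) ∪ ⁅ u ⁆  ≡⟨ cong (λ p → (⊥ ∪ p) ∪ ⁅ u ⁆) spread-⊥ ⟩
    (⊥ ∪ ⊥) ∪ ⁅ u ⁆           ≡⟨ cong (_∪ ⁅ u ⁆) (∪-identityˡ ⊥) ⟩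
    ⊥ ∪ ⁅ u ⁆                 ≡⟨ ∪-identityˡ ⁅ u ⁆ ⟩
    ⁅ u ⁆                     ∎
    where open ≡-Reasoning

  -- The singleton stands on the right so that the bounds on `∣ p ∪ ⁅ x ⁆ ∣` apply directly.
  closedNeighbourhood : Fin n → Subset n
  closedNeighbourhood u = neighbours G u ∪ ⁅ u ⁆

  burnRound-⁅_⁆ : ∀ u x → burnRound G ⁅ u ⁆ x ≡ closedNeighbourhood u ∪ ⁅ x ⁆
  burnRound-⁅ u ⁆ x = cong (_∪ ⁅ x ⁆)
    (trans (cong (⁅ u ⁆ ∪_) spread-⁅ u ⁆) (∪-comm ⁅ u ⁆ (neighbours G u)))

  burnTwoRounds : ∀ u x → burnRound G (burnRound G ⊥ u) x ≡ closedNeighbourhood u ∪ ⁅ x ⁆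
  burnTwoRounds u x = trans (cong (λ B → burnRound G B x) (burnRound-⊥ u)) (burnRound-⁅ u ⁆ x)

  degree≤maxDegree : ∀ u → degree G u ≤ maxDegree G
  degree≤maxDegree u =
    All.lookup (xs≤max 0 (map (degree G) (allFin n))) (∈-map⁺ (degree G) (∈-allFin u))

  maxDegree-attained : Fin n → ∃[ u ] maxDegree G ≤ degree G u
  maxDegree-attained u₀ with argmax-sel id 0 (map (degree G) (allFin n))
  -- The maximum may be the default 0 rather than a listed degree; then any vertex will do, and `u₀`
  -- provides one.
  ... | inj₁ max≡0 = u₀ , subst (_≤ degree G u₀) (sym max≡0) z≤n
  ... | inj₂ max∈degrees with u , _ , max≡deg ← ∈-map⁻ (degree G) max∈degrees =
    u , ≤-reflexive max≡deg

  Burnable : ℕ → Set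
  Burnable = BurnableFrom G ⊥

  burningNumber-burnable : Burnable (burningNumber G)
  burningNumber-burnable = proj₁ (proj₂ (shortestBurning G))

  burningNumber-minimal : ∀ {k} → Burnable k → burningNumber G ≤ k
  burningNumber-minimal = proj₂ (proj₂ (shortestBurning G))

  burnable₂⇒n∸2≤maxDegree : Burnable 2 → n ∸ 2 ≤ maxDegree G
  burnable₂⇒n∸2≤maxDegree (u ∷ x ∷ [] , round _ (round _ (done full))) =
    ≤-trans (m≤n+o⇒m∸n≤o n 2 n≤2+deg) (degree≤maxDegree u)
    where
    open ≤-Reasoning
    -- Each of the two sources adds at most one vertex to the neighbours of `u`.
    n≤2+deg : n ≤ 2 + degree G u
    n≤2+deg = begin
      n                                    ≤⟨ full⇒n≤∣p∣ full ⟩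
      ∣ burnRound G (burnRound G ⊥ u) x ∣  ≡⟨ cong ∣_∣ (burnTwoRounds u x) ⟩
      ∣ closedNeighbourhood u ∪ ⁅ x ⁆ ∣    ≤⟨ ∣p∪⁅x⁆∣≤1+∣p∣ (closedNeighbourhood u) x ⟩
      suc ∣ closedNeighbourhood u ∣        ≤⟨ s≤s (∣p∪⁅x⁆∣≤1+∣p∣ (neighbours G u) u) ⟩
      2 + degree G u                       ∎

  burnable⇒2≤ : 2 ≤ n → ∀ k → Burnable k → 2 ≤ k
  -- Matching on `2 ≤ n` exposes the vertex `zero`, which zero rounds leave unburned.
  burnable⇒2≤ (s≤s _) 0 ([] , done full) = contradiction (full zero) ∉⊥
  burnable⇒2≤ 2≤n 1 (u ∷ [] , round _ (done full)) = begin
    2                      ≤⟨ 2≤n ⟩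
    n                      ≤⟨ full⇒n≤∣p∣ full ⟩
    ∣ burnRound G ⊥ u ∣    ≡⟨ cong ∣_∣ (burnRound-⊥ u) ⟩
    ∣ ⁅ u ⁆ ∣              ≡⟨ ∣⁅x⁆∣≡1 u ⟩
    1                      ∎
    where open ≤-Reasoning
  burnable⇒2≤ _ (suc (suc _)) _ = s≤s (s≤s z≤n)

  -- After round one only `u` is burned, so `x ≢ u` makes `x` a legal source, even when `x` is a
  -- neighbour of `u`.
  covering⇒burnable₂ : ∀ {u x} → x ≢ u → (∀ v → v ∈ closedNeighbourhood u ∪ ⁅ x ⁆) → Burnable 2
  covering⇒burnable₂ {u} {x} x≢u full = u ∷ x ∷ [] ,
    round ∉⊥ (round (x≢u ∘ x∈⁅y⁆⇒x≡y u ∘ subst (x ∈_) (burnRound-⊥ u))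
                    (done λ v → subst (v ∈_) (sym (burnTwoRounds u x)) (full v)))

n∸2≤maxDegree⇒burnable₂ : ∀ {m} (G : SimpleGraph (suc (suc m))) → m ≤ maxDegree G → Burnable G 2
n∸2≤maxDegree⇒burnable₂ G m≤Δ =
  let u , Δ≤deg = maxDegree-attained G zero
      _ , x≢u , full = completingVertex {p = closedNeighbourhood G u}
        (q⊆p∪q (neighbours G u) ⁅ u ⁆ (x∈⁅x⁆ u))
        -- Since `u` is not its own neighbour, its closed neighbourhood has more than `degree G u`
        -- elements, hence at least `suc m`: all but at most one vertex.
        (≤-trans (s≤s (≤-trans m≤Δ Δ≤deg)) (x∉p⇒∣p∣<∣p∪⁅x⁆∣ (u∉neighbours G u)))
  in covering⇒burnable₂ G x≢u full

theorem3p1 : (n : ℕ) → n ≥ 2 → (G : SimpleGraph n) →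
    (burningNumber G ≡ 2) ⇔ (maxDegree G ≥ n ∸ 2)
theorem3p1 (suc (suc m)) 2≤n G = mk⇔
  (λ b≡2 → burnable₂⇒n∸2≤maxDegree G (subst (Burnable G) b≡2 (burningNumber-burnable G)))
  -- Minimality gives the upper bound; the lower bound holds because the shortest sequence is itself
  -- a burning sequence.
  (λ m≤Δ → ≤-antisym
    (burningNumber-minimal G (n∸2≤maxDegree⇒burnable₂ G m≤Δ))
    (burnable⇒2≤ G 2≤n (burningNumber G) (burningNumber-burnable G)))
theorem3p1 (suc zero) (s≤s ()) G
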